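{- Let $q$ be a power of an odd prime, $k\ge1$, and $E\subset\mathbb F_q^d$ with $|E|\gtrsim q^{\frac{d+k}{2}}$. For $y^1,\dots,y^k\in E$ let $$\Delta_{y^1,\dots,y^k}(E)=\{(\|x-y^1\|,\dots,\|x-y^k\|)\in\mathbb F_q^k: x\in E\}.$$ Then $$\frac1{|E|^k}\sum_{y^1,\dots,y^k\in E}|\Delta_{y^1,\dots,y^k}(E)|\gtrsim q^k.$$
   Context: $\mathbb F_q$ is the finite field with $q$ elements; for $x\in\mathbb F_q^d$, $\|x\|=x_1^2+\dots+x_d^2$. $X\gtrsim Y$ means $X\ge cY$ for a constant $c>0$ independent of $q$ and $E$ (possibly depending on $d,k$); the hypothesis $|E|\gtrsim q^{(d+k)/2}$ means $|E|\ge c_0q^{(d+k)/2}$ for some fixed constant $c_0>0$, and the constant in the conclusion may depend on $c_0$. -}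

module Defs where

open import Level using (0ℓ)
open import Data.Nat as ℕ using (ℕ; zero; suc)
open import Data.Fin using (Fin)
open import Data.Fin.Properties as FinP using ()
open import Data.Bool using (Bool; true; false; _∧_)
import Data.Bool
import Data.Bool.ListAction
import Data.Nat.ListAction
open import Data.Product using (Σ; _×_; _,_; proj₁)
open import Data.List as List using (List; []; _∷_)
open import Data.Vec as Vec using (Vec; []; _∷_)
open import Data.Vec.Properties as VecP using ()
open import Function.Bundles using (_↔_; Inverse)
open import Relation.Binary.PropositionalEquality using (_≡_; _≢_; cong; sym; trans)
open import Relation.Nullary using (Dec; yes; no; ¬_)
open import Relation.Nullary.Decidable using (⌊_⌋)
open import Algebra.Core using (Op₁; Op₂)
open import Algebra.Structures using (IsCommutativeRing)
open import Data.Nat.Primality using (Prime)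

record FiniteField : Set₁ where
  field
    Carrier : Set
    _+_ _*_ : Op₂ Carrier
    -_      : Op₁ Carrier
    0# 1#   : Carrier
    isCommutativeRing : IsCommutativeRing _≡_ _+_ _*_ -_ 0# 1#
    0≢1     : 0# ≢ 1#
    inverse : ∀ x → x ≢ 0# → Σ Carrier (λ y → x * y ≡ 1#)
    size    : ℕ
    enum    : Fin size ↔ Carrier

  infixl 6 _+_
  infixl 7 _*_

  _≟_ : (x y : Carrier) → Dec (x ≡ y)
  x ≟ y with Inverse.from enum x FinP.≟ Inverse.from enum y
  ... | yes p = yes (trans (sym (Inverse.strictlyInverseˡ enum x))
                      (trans (cong (Inverse.to enum) p) (Inverse.strictlyInverseˡ enum y)))
  ... | no ¬p = no (λ e → ¬p (cong (Inverse.from enum) e))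

  elements : List Carrier
  elements = List.map (Inverse.to enum) (List.allFin size)


IsOddPrimePower : ℕ → Set
IsOddPrimePower q = Σ ℕ (λ p → Σ ℕ (λ n → Prime p × (p ≢ 2) × (q ≡ p ℕ.^ n)))

allVecs : {A : Set} → List A → (n : ℕ) → List (Vec A n)
allVecs xs zero    = [] ∷ []
allVecs xs (suc n) = List.concatMap (λ x → List.map (x ∷_) (allVecs xs n)) xs

module _ (F : FiniteField) where
  open FiniteField F

  _≟V_ : ∀ {n} (u v : Vec Carrier n) → Dec (u ≡ v)
  _≟V_ = VecP.≡-dec _≟_

  points : (d : ℕ) → List (Vec Carrier d)
  points d = allVecs elements d

  ‖_‖ : ∀ {d} → Vec Carrier d → Carrier
  ‖ x ‖ = Vec.foldr _ _+_ 0# (Vec.map (λ a → a * a) x)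

  _−_ : ∀ {d} → Vec Carrier d → Vec Carrier d → Vec Carrier d
  x − y = Vec.zipWith (λ a b → a + (- b)) x y

  Subset : ℕ → Set
  Subset d = Vec Carrier d → Bool

  -- the elements of E, listed without repetition
  elemsOf : ∀ {d} → Subset d → List (Vec Carrier d)
  elemsOf {d} E = List.filter (λ x → E x Data.Bool.≟ true) (points d)

  card : ∀ {d} → Subset d → ℕ
  card E = List.length (elemsOf E)

  distVec : ∀ {d k} → Vec (Vec Carrier d) k → Vec Carrier d → Vec Carrier k
  distVec ys x = Vec.map (λ y → ‖ x − y ‖) ys

  Δ : ∀ {d k} → Subset d → Vec (Vec Carrier d) k → Subset k
  Δ E ys t = Data.Bool.ListAction.any (λ x → ⌊ distVec ys x ≟V t ⌋) (elemsOf E)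

  sumΔ : ∀ {d} (k : ℕ) → Subset d → ℕ
  sumΔ k E = Data.Nat.ListAction.sum (List.map (λ ys → card (Δ E ys)) (allVecs (elemsOf E) k))

{-# OPTIONS --safe #-}

-- For y ∈ E^j let N(y) count the pairs x, x′ ∈ E with the same distances to all of y¹, …, yʲ,
-- and let N_j = Σ_{y ∈ E^j} N(y).  Refining a partition into at most q parts divides its collision
-- number by at most q, so the deviations q N(z, y) − N(y) are nonnegative for every point z.
-- Their sum over z ∈ E is therefore at most their sum over all z, which is at most q^{d+1}|E|
-- because the bisector of x ≠ x′ is a hyperplane (this is where 2 ≠ 0 is needed).
-- By recursion q^k N_k ≤ |E|^{k+2} + k q^{d+k} |E|^k, and Cauchy–Schwarz in the form
-- |E|^{2k+2} ≤ (Σ_y |Δ_y(E)|) N_k concludes.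

module Submission where

open import Defs
open import Data.Nat using (ℕ; _+_; _*_; _^_; _≤_)
open import Data.Product using (Σ; _×_)
open import Algebra.Bundles using (CommutativeRing)
import Algebra.Properties.Ring
open import Data.Bool using (true; false)
import Data.Bool as Bool
open import Data.Bool.ListAction using (any)
open import Data.Empty using (⊥-elim)
open import Data.Fin using (Fin; zero; suc; toℕ)
import Data.Fin.Properties as Fin
open import Data.List using (List; []; _∷_; _++_; map; length; filter; concatMap; allFin; tabulate)
open import Data.List.Properties using (map-tabulate; length-map; length-tabulate)
open import Data.Nat using (zero; suc; _<?_; z≤n; s≤s; NonZero; >-nonZero)
open import Data.Nat.Divisibility using (_∣_; divides; ∣1⇒≡1)
open import Data.Nat.ListAction using (sum)
open import Data.Nat.Primality using (prime⇒irreducible; prime[2]; euclidsLemma)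
open import Data.Nat.Properties hiding (_≟_)
open import Data.Nat.Tactic.RingSolver using (solve-∀)
open import Data.Product using (_,_)
open import Data.Sum using (_⊎_; inj₁; inj₂; [_,_]′)
open import Data.Vec using (Vec; []; _∷_)
open import Data.Vec.Properties using (∷-injective)
open import Function using (_∘_)
open import Function.Bundles using (Inverse)
open import Level using (0ℓ)
open import Relation.Binary.Definitions using (tri<; tri≈; tri>)
open import Relation.Binary.PropositionalEquality
open import Relation.Nullary using (Dec; yes; no; ¬_)
open import Relation.Nullary.Decidable using (⌊_⌋)

private variable
  A B P Q R : Set

-- Finite sums

∑ : List A → (A → ℕ) → ℕ
∑ xs f = sum (map f xs)

syntax ∑ xs (λ x → e) = ∑[ x ← xs ] e
infixr 5 ∑

∑-mono : (xs : List A) {f g : A → ℕ} → (∀ x → f x ≤ g x) → ∑ xs f ≤ ∑ xs g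
∑-mono []       f≤g = z≤n
∑-mono (x ∷ xs) f≤g = +-mono-≤ (f≤g x) (∑-mono xs f≤g)

∑-cong : (xs : List A) {f g : A → ℕ} → (∀ x → f x ≡ g x) → ∑ xs f ≡ ∑ xs g
∑-cong []       f≡g = refl
∑-cong (x ∷ xs) f≡g = cong₂ _+_ (f≡g x) (∑-cong xs f≡g)

∑-+ : (xs : List A) (f g : A → ℕ) → ∑[ x ← xs ] (f x + g x) ≡ ∑ xs f + ∑ xs g
∑-+ []       f g = refl
∑-+ (x ∷ xs) f g = trans (cong (f x + g x +_) (∑-+ xs f g)) (rearrange (f x) (g x) _ _)
  where
  rearrange : ∀ a b c d → a + b + (c + d) ≡ a + c + (b + d)
  rearrange = solve-∀

∑-*ˡ : (xs : List A) (c : ℕ) (f : A → ℕ) → ∑[ x ← xs ] (c * f x) ≡ c * ∑ xs f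
∑-*ˡ []       c f = sym (*-zeroʳ c)
∑-*ˡ (x ∷ xs) c f = trans (cong (c * f x +_) (∑-*ˡ xs c f)) (sym (*-distribˡ-+ c (f x) _))

∑-*ʳ : (xs : List A) (f : A → ℕ) (c : ℕ) → ∑[ x ← xs ] (f x * c) ≡ ∑ xs f * c
∑-*ʳ xs f c = trans (∑-cong xs (λ x → *-comm (f x) c)) (trans (∑-*ˡ xs c f) (*-comm c _))

∑-const : (xs : List A) (c : ℕ) → ∑[ _ ← xs ] c ≡ length xs * c
∑-const []       c = refl
∑-const (x ∷ xs) c = cong (c +_) (∑-const xs c)

∑-swap : (xs : List A) (ys : List B) (f : A → B → ℕ) →
  ∑[ x ← xs ] ∑[ y ← ys ] f x y ≡ ∑[ y ← ys ] ∑[ x ← xs ] f x y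
∑-swap []       ys f = sym (trans (∑-const ys 0) (*-zeroʳ (length ys)))
∑-swap (x ∷ xs) ys f = trans (cong (∑ ys (f x) +_) (∑-swap xs ys f)) (sym (∑-+ ys (f x) _))

∑-* : (xs : List A) (ys : List B) (f : A → ℕ) (g : B → ℕ) →
  ∑ xs f * ∑ ys g ≡ ∑[ x ← xs ] ∑[ y ← ys ] (f x * g y)
∑-* xs ys f g = trans (sym (∑-*ʳ xs f _)) (∑-cong xs (λ x → sym (∑-*ˡ ys (f x) g)))

∑-++ : (xs ys : List A) (f : A → ℕ) → ∑ (xs ++ ys) f ≡ ∑ xs f + ∑ ys f
∑-++ []       ys f = refl
∑-++ (x ∷ xs) ys f = trans (cong (f x +_) (∑-++ xs ys f)) (sym (+-assoc (f x) _ _))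

∑-map : (h : A → B) (xs : List A) (f : B → ℕ) → ∑ (map h xs) f ≡ ∑ xs (f ∘ h)
∑-map h []       f = refl
∑-map h (x ∷ xs) f = cong (f (h x) +_) (∑-map h xs f)

∑-concatMap : (h : A → List B) (xs : List A) (f : B → ℕ) →
  ∑ (concatMap h xs) f ≡ ∑[ x ← xs ] ∑ (h x) f
∑-concatMap h []       f = refl
∑-concatMap h (x ∷ xs) f = trans (∑-++ (h x) _ f) (cong (∑ (h x) f +_) (∑-concatMap h xs f))

∑-allVecs : (xs : List A) (n : ℕ) (f : Vec A (suc n) → ℕ) →
  ∑ (allVecs xs (suc n)) f ≡ ∑[ x ← xs ] ∑[ v ← allVecs xs n ] f (x ∷ v)
∑-allVecs xs n f = trans (∑-concatMap _ xs f) (∑-cong xs (λ x → ∑-map (x ∷_) (allVecs xs n) f))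

length-allVecs : (xs : List A) (n : ℕ) → length (allVecs xs n) ≡ length xs ^ n
length-allVecs xs n = trans (sym (*-identityʳ _)) (trans (sym (∑-const (allVecs xs n) 1)) (count n))
  where
  count : ∀ n → ∑[ _ ← allVecs xs n ] 1 ≡ length xs ^ n
  count zero    = refl
  count (suc n) = trans (∑-allVecs xs n _) (trans (∑-cong xs (λ _ → count n)) (∑-const xs _))

∑-filter-≤ : {S : A → Set} (S? : ∀ x → Dec (S x)) (xs : List A) (f : A → ℕ) →
  ∑ (filter S? xs) f ≤ ∑ xs f
∑-filter-≤ S? []       f = z≤n
∑-filter-≤ S? (x ∷ xs) f with S? x
... | yes _ = +-monoʳ-≤ (f x) (∑-filter-≤ S? xs f)
... | no  _ = ≤-trans (∑-filter-≤ S? xs f) (m≤n+m _ (f x))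

-- If f ≥ c, then the sum of f − c over a sublist is at most the sum over the whole list;
-- both sides are moved so that no subtraction occurs.
∑-deviation : {S : A → Set} (S? : ∀ x → Dec (S x)) (xs : List A) (f : A → ℕ) (c : ℕ) →
  (∀ x → c ≤ f x) →
  ∑ (filter S? xs) f + length xs * c ≤ ∑ xs f + length (filter S? xs) * c
∑-deviation S? []       f c c≤f = z≤n
∑-deviation S? (x ∷ xs) f c c≤f with S? x
... | yes _ = ≤-trans (≤-reflexive (rearrange (f x) _ c _))
                (≤-trans (+-monoʳ-≤ (f x + c) (∑-deviation S? xs f c c≤f))
                  (≤-reflexive (sym (rearrange (f x) _ c _))))
  where
  rearrange : ∀ a b c d → a + b + (c + d) ≡ a + c + (b + d)
  rearrange = solve-∀
... | no  _ = ≤-trans (≤-reflexive (rearrange (∑ (filter S? xs) f) c _))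
                (≤-trans (+-mono-≤ (c≤f x) (∑-deviation S? xs f c c≤f))
                  (≤-reflexive (sym (+-assoc (f x) _ _))))
  where
  rearrange : ∀ a b c → a + (b + c) ≡ b + (a + c)
  rearrange = solve-∀

-- The Cauchy–Schwarz inequality

m*m≤n*n⇒m≤n : ∀ {m n} → m * m ≤ n * n → m ≤ n
m*m≤n*n⇒m≤n {m} {n} m²≤n² with <-cmp m n
... | tri< m<n _ _ = <⇒≤ m<n
... | tri≈ _ m≡n _ = ≤-reflexive m≡n
... | tri> _ _ n<m = ⊥-elim (<⇒≱ (*-mono-< n<m n<m) m²≤n²)

-- By symmetry let n = m + e; the two sides then differ by e², so no subtraction occurs.
2mn≤m²+n² : ∀ m n → 2 * (m * n) ≤ m * m + n * n
2mn≤m²+n² m n = [ ordered m n , (λ n≤m → subst₂ _≤_ (cong (2 *_) (*-comm n m)) (+-comm (n * n) _) (ordered n m n≤m)) ]′ (≤-total m n)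
  where
  expand : ∀ m e → 2 * (m * (m + e)) + e * e ≡ m * m + (m + e) * (m + e)
  expand = solve-∀
  ordered : ∀ m n → m ≤ n → 2 * (m * n) ≤ m * m + n * n
  ordered m n m≤n with m≤n⇒∃[o]m+o≡n m≤n
  ... | e , refl = ≤-trans (m≤m+n _ (e * e)) (≤-reflexive (expand m e))

-- AM-GM with the square roots cleared: (2uv)² ≤ 4(pr)(PR) = 4(pR)(Pr) ≤ (pR + Pr)².
cross-term : ∀ u v p r P R → u * u ≤ p * r → v * v ≤ P * R → 2 * (u * v) ≤ p * R + P * r
cross-term u v p r P R u²≤pr v²≤PR = m*m≤n*n⇒m≤n (begin
  2 * (u * v) * (2 * (u * v))                 ≡⟨ square u v ⟩
  4 * (u * u * (v * v))                       ≤⟨ *-monoʳ-≤ 4 (*-mono-≤ u²≤pr v²≤PR) ⟩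
  4 * (p * r * (P * R))                       ≡⟨ regroup p r P R ⟩
  2 * (x * y) + 2 * (x * y)                   ≤⟨ +-monoˡ-≤ _ (2mn≤m²+n² x y) ⟩
  x * x + y * y + 2 * (x * y)                 ≡⟨ binomial x y ⟩
  (x + y) * (x + y)                           ∎)
  where
  open ≤-Reasoning
  x = p * R
  y = P * r
  square : ∀ u v → 2 * (u * v) * (2 * (u * v)) ≡ 4 * (u * u * (v * v))
  square = solve-∀
  regroup : ∀ p r P R → 4 * (p * r * (P * R)) ≡ 2 * (p * R * (P * r)) + 2 * (p * R * (P * r))
  regroup = solve-∀
  binomial : ∀ x y → x * x + y * y + 2 * (x * y) ≡ (x + y) * (x + y)
  binomial = solve-∀

-- The hypothesis u² ≤ pr replaces u = √p √r, which keeps everything in ℕ and leaves p free to be a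
-- constant, an indicator or a cardinality. In the induction `cross-term` bounds the mixed term of
-- the expanded square.
cauchy-schwarz : (xs : List A) {u p r : A → ℕ} → (∀ x → u x * u x ≤ p x * r x) →
  ∑ xs u * ∑ xs u ≤ ∑ xs p * ∑ xs r
cauchy-schwarz []       u²≤pr = z≤n
cauchy-schwarz (x ∷ xs) {u} {p} {r} u²≤pr = begin
  (u x + U) * (u x + U)                             ≡⟨ square (u x) U ⟩
  u x * u x + 2 * (u x * U) + U * U                 ≤⟨ +-mono-≤ (+-mono-≤ (u²≤pr x) (cross-term (u x) U (p x) (r x) (∑ xs p) (∑ xs r) (u²≤pr x) U²≤PR)) U²≤PR ⟩
  p x * r x + (p x * ∑ xs r + ∑ xs p * r x) + ∑ xs p * ∑ xs r  ≡⟨ product (p x) (r x) _ _ ⟨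
  (p x + ∑ xs p) * (r x + ∑ xs r)                   ∎
  where
  open ≤-Reasoning
  U = ∑ xs u
  U²≤PR = cauchy-schwarz xs u²≤pr
  square : ∀ u v → (u + v) * (u + v) ≡ u * u + 2 * (u * v) + v * v
  square = solve-∀
  product : ∀ p r P R → (p + P) * (r + R) ≡ p * r + (p * R + P * r) + P * R
  product = solve-∀

-- Indicators

𝟙 : Dec P → ℕ
𝟙 (yes _) = 1
𝟙 (no  _) = 0

𝟙-mono : (P? : Dec P) (Q? : Dec Q) → (P → Q) → 𝟙 P? ≤ 𝟙 Q?
𝟙-mono (no  _) _       P⇒Q = z≤n
𝟙-mono (yes p) (yes _) P⇒Q = ≤-refl
𝟙-mono (yes p) (no ¬q) P⇒Q = ⊥-elim (¬q (P⇒Q p))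

𝟙-cong : (P? : Dec P) (Q? : Dec Q) → (P → Q) → (Q → P) → 𝟙 P? ≡ 𝟙 Q?
𝟙-cong P? Q? P⇒Q Q⇒P = ≤-antisym (𝟙-mono P? Q? P⇒Q) (𝟙-mono Q? P? Q⇒P)

𝟙-× : (P? : Dec P) (Q? : Dec Q) (R? : Dec R) → (P → Q × R) → (Q → R → P) → 𝟙 P? ≡ 𝟙 Q? * 𝟙 R?
𝟙-× P? (yes q) (yes r) split join = 𝟙-cong P? (yes q) (λ _ → q) (λ _ → join q r)
𝟙-× P? (yes q) (no ¬r) split join = 𝟙-cong P? (no ¬r) (λ p → let _ , r = split p in r) (⊥-elim ∘ ¬r)
𝟙-× P? (no ¬q) R?      split join = 𝟙-cong P? (no ¬q) (λ p → let q , _ = split p in q) (⊥-elim ∘ ¬q)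

𝟙-filter : {S : A → Set} (S? : ∀ x → Dec (S x)) (xs : List A) →
  length (filter S? xs) ≡ ∑[ x ← xs ] 𝟙 (S? x)
𝟙-filter S? []       = refl
𝟙-filter S? (x ∷ xs) with S? x
... | yes _ = cong suc (𝟙-filter S? xs)
... | no  _ = 𝟙-filter S? xs

any≡false⇒∑≡0 : {S : A → Set} (S? : ∀ x → Dec (S x)) (xs : List A) →
  any (λ x → ⌊ S? x ⌋) xs ≡ false → ∑[ x ← xs ] 𝟙 (S? x) ≡ 0
any≡false⇒∑≡0 S? []       _  = refl
any≡false⇒∑≡0 S? (x ∷ xs) eq with S? x
... | no _ = any≡false⇒∑≡0 S? xs eq

∑-allFin-𝟙 : ∀ {n} (j : Fin n) → ∑[ i ← allFin n ] 𝟙 (j Fin.≟ i) ≡ 1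
∑-allFin-𝟙 {suc n} j = trans (cong (𝟙 (j Fin.≟ zero) +_) reindex) (split j)
  where
  reindex : ∑[ i ← tabulate suc ] 𝟙 (j Fin.≟ i) ≡ ∑[ i ← allFin n ] 𝟙 (j Fin.≟ suc i)
  reindex = trans (cong (λ is → ∑[ i ← is ] 𝟙 (j Fin.≟ i)) (sym (map-tabulate (λ i → i) suc)))
              (∑-map suc (allFin n) _)
  split : (j : Fin (suc n)) → 𝟙 (j Fin.≟ zero) + (∑[ i ← allFin n ] 𝟙 (j Fin.≟ suc i)) ≡ 1
  split zero    = cong suc (trans (∑-const (allFin n) 0) (*-zeroʳ (length (allFin n))))
  split (suc j) = trans (∑-cong (allFin n) (λ i → 𝟙-cong (suc j Fin.≟ suc i) (j Fin.≟ i) Fin.suc-injective (cong suc)))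
                    (∑-allFin-𝟙 j)

-- Complete enumerations, involutions and parity

Enumerates : (xs : List A) → (∀ (x y : A) → Dec (x ≡ y)) → Set
Enumerates {A} xs _≟_ = ∀ (w : A) → ∑[ x ← xs ] 𝟙 (w ≟ x) ≡ 1

-- Since each value is listed exactly once, `𝟙 (w ≟ x)` acts as a Kronecker delta.
∑-sift : {_≟_ : ∀ (x y : A) → Dec (x ≡ y)} (xs : List A) → Enumerates xs _≟_ → ∀ w (f : A → ℕ) →
  ∑[ x ← xs ] (𝟙 (w ≟ x) * f x) ≡ f w
∑-sift {_≟_ = _≟_} xs enumerates w f =
  trans (∑-cong xs (λ x → transport (w ≟ x)))
    (trans (∑-*ʳ xs _ (f w)) (trans (cong (_* f w) (enumerates w)) (*-identityˡ (f w))))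
  where
  transport : ∀ {x} (w≟x : Dec (w ≡ x)) → 𝟙 w≟x * f x ≡ 𝟙 w≟x * f w
  transport (yes refl) = refl
  transport (no _)     = refl

-- Sifting and swapping weight each f y by the number of preimages of y, and this is 1 because σ x =
-- y exactly when x = σ y.
∑-involution : {_≟_ : ∀ (x y : A) → Dec (x ≡ y)} (xs : List A) → Enumerates xs _≟_ →
  (σ : A → A) → (∀ x → σ (σ x) ≡ x) → (f : A → ℕ) → ∑ xs (f ∘ σ) ≡ ∑ xs f
∑-involution {_≟_ = _≟_} xs enumerates σ σσ f = begin
  ∑[ x ← xs ] f (σ x)                              ≡⟨ ∑-cong xs (λ x → ∑-sift xs enumerates (σ x) f) ⟨
  ∑[ x ← xs ] ∑[ y ← xs ] (𝟙 (σ x ≟ y) * f y)      ≡⟨ ∑-swap xs xs _ ⟩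
  ∑[ y ← xs ] ∑[ x ← xs ] (𝟙 (σ x ≟ y) * f y)      ≡⟨ ∑-cong xs (λ y → ∑-*ʳ xs _ (f y)) ⟩
  ∑[ y ← xs ] ((∑[ x ← xs ] 𝟙 (σ x ≟ y)) * f y)    ≡⟨ ∑-cong xs (λ y → cong (_* f y) (preimage y)) ⟩
  ∑[ y ← xs ] (1 * f y)                            ≡⟨ ∑-cong xs (λ y → *-identityˡ (f y)) ⟩
  ∑ xs f                                           ∎
  where
  open ≡-Reasoning
  preimage : ∀ y → ∑[ x ← xs ] 𝟙 (σ x ≟ y) ≡ 1
  preimage y = trans (∑-cong xs (λ x → 𝟙-cong (σ x ≟ y) (σ y ≟ x)
                        (λ e → trans (cong σ (sym e)) (σσ x)) (λ e → trans (cong σ (sym e)) (σσ y))))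
                 (enumerates (σ y))

-- Every orbit {x, σ x} has exactly one element whose index is smaller than that of its partner.
fixed-point-free-involution⇒even : {_≟_ : ∀ (x y : A) → Dec (x ≡ y)} (xs : List A) → Enumerates xs _≟_ →
  (index : A → ℕ) → (∀ {x y} → index x ≡ index y → x ≡ y) →
  (σ : A → A) → (∀ x → σ (σ x) ≡ x) → (∀ x → σ x ≢ x) → 2 ∣ length xs
fixed-point-free-involution⇒even xs enumerates index index-injective σ σσ σx≢x = divides m (begin
  length xs                                        ≡⟨ *-identityʳ _ ⟨
  length xs * 1                                    ≡⟨ ∑-const xs 1 ⟨
  ∑[ _ ← xs ] 1                                    ≡⟨ ∑-cong xs compare ⟩
  ∑[ x ← xs ] (lower x + upper x)                  ≡⟨ ∑-+ xs lower upper ⟩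
  -- Rewriting x as σ (σ x) exhibits `upper` as `lower ∘ σ`, so both sums equal m.
  m + ∑ xs upper                                   ≡⟨ cong (m +_) (∑-cong xs (λ x → cong (λ z → 𝟙 (index (σ x) <? index z)) (sym (σσ x)))) ⟩
  m + ∑ xs (lower ∘ σ)                             ≡⟨ cong (m +_) (∑-involution xs enumerates σ σσ lower) ⟩
  m + m                                            ≡⟨ cong (m +_) (+-identityʳ m) ⟨
  2 * m                                            ≡⟨ *-comm 2 m ⟩
  m * 2                                            ∎)
  where
  open ≡-Reasoning
  lower upper : _ → ℕ
  lower x = 𝟙 (index x <? index (σ x))
  upper x = 𝟙 (index (σ x) <? index x)
  m = ∑ xs lower
  compare : ∀ x → 1 ≡ lower x + upper x
  compare x with index x <? index (σ x) | index (σ x) <? index x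
  ... | yes p | yes q = ⊥-elim (<-asym p q)
  ... | yes _ | no  _ = refl
  ... | no  _ | yes _ = refl
  ... | no ¬p | no ¬q = ⊥-elim (σx≢x x (index-injective (≤-antisym (≮⇒≥ ¬p) (≮⇒≥ ¬q))))

odd-prime-power⇒odd : ∀ {q} → IsOddPrimePower q → ¬ 2 ∣ q
odd-prime-power⇒odd (p , n , p-prime , p≢2 , refl) = power n
  where
  2∤1 : ¬ 2 ∣ 1
  2∤1 2∣1 with () ← ∣1⇒≡1 2∣1
  power : ∀ n → ¬ 2 ∣ p ^ n
  power zero    2∣1 = 2∤1 2∣1
  power (suc n) 2∣pⁿ⁺¹ with euclidsLemma p (p ^ n) prime[2] 2∣pⁿ⁺¹
  ... | inj₂ 2∣pⁿ = power n 2∣pⁿ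
  ... | inj₁ 2∣p with prime⇒irreducible p-prime 2∣p
  ...   | inj₁ ()
  ...   | inj₂ 2≡p = p≢2 (sym 2≡p)

-- Either no entry satisfies S and the sum is 0, or some w does and every indicator is at most that
-- of w = x, which sums to 1.
∑-𝟙-unique≤1 : {_≟_ : ∀ (x y : A) → Dec (x ≡ y)} (xs : List A) → Enumerates xs _≟_ →
  {S : A → Set} (S? : ∀ x → Dec (S x)) → (∀ {x y} → S x → S y → x ≡ y) → ∑[ x ← xs ] 𝟙 (S? x) ≤ 1
∑-𝟙-unique≤1 {A} {_≟_} xs enumerates {S} S? unique with find xs
  where
  find : (ys : List A) → Σ A S ⊎ ∑[ x ← ys ] 𝟙 (S? x) ≡ 0
  find []       = inj₂ refl
  find (y ∷ ys) with S? y
  ... | yes s = inj₁ (y , s)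
  ... | no  _ = find ys
... | inj₂ ∑≡0     = ≤-trans (≤-reflexive ∑≡0) z≤n
... | inj₁ (w , s) = ≤-trans (∑-mono xs (λ x → 𝟙-mono (S? x) (w ≟ x) (unique s))) (≤-reflexive (enumerates w))

-- Distances over a finite field

module _ (F : FiniteField) where
  open FiniteField F using (Carrier; 0#; 1#; isCommutativeRing; 0≢1; inverse; _≟_; enum; elements)
    renaming (size to q; _+_ to _⊕_; _*_ to _⊗_; -_ to ⊖_)

  private
    ring : CommutativeRing 0ℓ 0ℓ
    ring = record { isCommutativeRing = isCommutativeRing }

    module 𝔽 = CommutativeRing ring
    module 𝔽ₚ = Algebra.Properties.Ring 𝔽.ring

    _≟ᵥ_ : ∀ {n} (u v : Vec Carrier n) → Dec (u ≡ v)
    _≟ᵥ_ = _≟V_ F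

  elements-enumerate : Enumerates elements _≟_
  elements-enumerate w = begin
    ∑[ x ← elements ] 𝟙 (w ≟ x)                  ≡⟨ ∑-map to (allFin q) _ ⟩
    ∑[ i ← allFin q ] 𝟙 (w ≟ to i)               ≡⟨ ∑-cong (allFin q) (λ i → 𝟙-cong (w ≟ to i) (from w Fin.≟ i)
                                                      (λ e → trans (cong from e) (strictlyInverseʳ i))
                                                      (λ e → trans (sym (strictlyInverseˡ w)) (cong to e))) ⟩
    ∑[ i ← allFin q ] 𝟙 (from w Fin.≟ i)         ≡⟨ ∑-allFin-𝟙 (from w) ⟩
    1                                            ∎
    where
    open ≡-Reasoning
    open Inverse enum using (to; from; strictlyInverseˡ; strictlyInverseʳ)

  length-elements : length elements ≡ q
  length-elements = trans (length-map _ (allFin q)) (length-tabulate (λ i → i))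

  size≢0 : NonZero q
  size≢0 = >-nonZero (≤-trans (s≤s z≤n) (Fin.toℕ<n (Inverse.from enum 0#)))

  𝟙-∷ : ∀ {n} a b (u v : Vec Carrier n) → 𝟙 ((a ∷ u) ≟ᵥ (b ∷ v)) ≡ 𝟙 (a ≟ b) * 𝟙 (u ≟ᵥ v)
  𝟙-∷ a b u v = 𝟙-× ((a ∷ u) ≟ᵥ (b ∷ v)) (a ≟ b) (u ≟ᵥ v) ∷-injective (cong₂ _∷_)

  points-enumerate : ∀ n → Enumerates (points F n) _≟ᵥ_
  points-enumerate zero    []      = refl
  points-enumerate (suc n) (a ∷ w) = begin
    ∑[ v ← points F (suc n) ] 𝟙 ((a ∷ w) ≟ᵥ v)                            ≡⟨ ∑-allVecs elements n _ ⟩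
    ∑[ z ← elements ] ∑[ v ← points F n ] 𝟙 ((a ∷ w) ≟ᵥ (z ∷ v))          ≡⟨ ∑-cong elements (λ z → ∑-cong (points F n) (λ v → 𝟙-∷ a z w v)) ⟩
    ∑[ z ← elements ] ∑[ v ← points F n ] (𝟙 (a ≟ z) * 𝟙 (w ≟ᵥ v))        ≡⟨ ∑-* elements (points F n) _ _ ⟨
    (∑[ z ← elements ] 𝟙 (a ≟ z)) * (∑[ v ← points F n ] 𝟙 (w ≟ᵥ v))      ≡⟨ cong₂ _*_ (elements-enumerate a) (points-enumerate n w) ⟩
    1                                                                     ∎
    where open ≡-Reasoning

  length-points : ∀ n → length (points F n) ≡ q ^ n
  length-points n = trans (length-allVecs elements n) (cong (_^ n) length-elements)

  ⊗-cancelˡ : ∀ {u x y} → u ≢ 0# → u ⊗ x ≡ u ⊗ y → x ≡ y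
  ⊗-cancelˡ {u} {x} {y} u≢0 ux≡uy with inverse u u≢0
  ... | v , uv≡1 = trans (sym (undo x)) (trans (cong (v ⊗_) ux≡uy) (undo y))
    where
    undo : ∀ z → v ⊗ (u ⊗ z) ≡ z
    undo z = trans (sym (𝔽.*-assoc v u z))
               (trans (cong (_⊗ z) (trans (𝔽.*-comm v u) uv≡1)) (𝔽.*-identityˡ z))

  -- If 1 + 1 = 0, then x ↦ x + 1 is an involution, without fixed points because 0 ≠ 1, and the
  -- field would have an even number of elements.
  odd-size⇒1+1≢0 : ¬ 2 ∣ q → 1# ⊕ 1# ≢ 0#
  odd-size⇒1+1≢0 2∤q 1+1≡0 = 2∤q (subst (2 ∣_) length-elements
    (fixed-point-free-involution⇒even elements elements-enumerate
      (toℕ ∘ Inverse.from enum) (from-injective ∘ Fin.toℕ-injective)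
      (_⊕ 1#)
      (λ x → trans (𝔽.+-assoc x 1# 1#) (trans (cong (x ⊕_) 1+1≡0) (𝔽.+-identityʳ x)))
      (λ x x+1≡x → 0≢1 (sym (𝔽ₚ.+-cancelˡ x 1# 0# (trans x+1≡x (sym (𝔽.+-identityʳ x))))))))
    where
    from-injective : ∀ {x y} → Inverse.from enum x ≡ Inverse.from enum y → x ≡ y
    from-injective {x} {y} e = trans (sym (Inverse.strictlyInverseˡ enum x))
                                 (trans (cong (Inverse.to enum) e) (Inverse.strictlyInverseˡ enum y))

  -- With b = a + c, the difference of the two equations reads 2cz = 2cw.
  bisector-unique : 1# ⊕ 1# ≢ 0# → ∀ {a b m m′ z w} → a ≢ b →
    (a ⊕ ⊖ z) ⊗ (a ⊕ ⊖ z) ⊕ m ≡ (b ⊕ ⊖ z) ⊗ (b ⊕ ⊖ z) ⊕ m′ →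
    (a ⊕ ⊖ w) ⊗ (a ⊕ ⊖ w) ⊕ m ≡ (b ⊕ ⊖ w) ⊗ (b ⊕ ⊖ w) ⊕ m′ → z ≡ w
  bisector-unique 2≢0 {a} {b} {m} {m′} {z} {w} a≢b =
    subst (λ b → (a ⊕ ⊖ z) ⊗ (a ⊕ ⊖ z) ⊕ m ≡ (b ⊕ ⊖ z) ⊗ (b ⊕ ⊖ z) ⊕ m′ →
                 (a ⊕ ⊖ w) ⊗ (a ⊕ ⊖ w) ⊕ m ≡ (b ⊕ ⊖ w) ⊗ (b ⊕ ⊖ w) ⊕ m′ → z ≡ w)
      a+c≡b λ eqz eqw → 𝔽ₚ.-‿injective (sym (⊗-cancelˡ c≢0 (⊗-cancelˡ 2≢0 (𝔽ₚ.+-cancelˡ _ _ _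
        (trans (sym (expandˡ a c (⊖ z) (⊖ w) m m′))
          (trans (cong₂ _⊕_ eqz (sym eqw)) (expandʳ a c (⊖ z) (⊖ w) m m′)))))))
    where
    c = b ⊕ ⊖ a
    a+c≡b : a ⊕ c ≡ b
    a+c≡b = trans (cong (a ⊕_) (𝔽.+-comm b (⊖ a)))
              (trans (sym (𝔽.+-assoc a (⊖ a) b))
                (trans (cong (_⊕ b) (𝔽.-‿inverseʳ a)) (𝔽.+-identityˡ b)))
    c≢0 : c ≢ 0#
    c≢0 c≡0 = a≢b (trans (sym (𝔽.+-identityʳ a)) (trans (cong (a ⊕_) (sym c≡0)) a+c≡b))
    -- This solver knows semirings only. Hence -z and -w enter as variables, b is replaced by a + c,
    -- and the equation for z is added to the reversed equation for w. Both sides then share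
    -- `common`, leaving 2c(-w) = 2c(-z).
    open import Algebra.Solver.Ring.NaturalCoefficients.Default 𝔽.commutativeSemiring
      using (solve; _:=_; _:+_; _:*_; con)
    common : Carrier → Carrier → Carrier → Carrier → Carrier → Carrier → Carrier
    common a c n n′ m m′ =
      (a ⊕ n) ⊗ (a ⊕ n) ⊕ (a ⊕ n′) ⊗ (a ⊕ n′) ⊕ m ⊕ m′ ⊕ c ⊗ (a ⊕ a ⊕ c)
    expandˡ : ∀ a c n n′ m m′ →
      ((a ⊕ n) ⊗ (a ⊕ n) ⊕ m) ⊕ ((a ⊕ c ⊕ n′) ⊗ (a ⊕ c ⊕ n′) ⊕ m′) ≡ common a c n n′ m m′ ⊕ (1# ⊕ 1#) ⊗ (c ⊗ n′)
    expandˡ = solve 6 (λ a c n n′ m m′ →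
      ((a :+ n) :* (a :+ n) :+ m) :+ ((a :+ c :+ n′) :* (a :+ c :+ n′) :+ m′) :=
      ((a :+ n) :* (a :+ n) :+ (a :+ n′) :* (a :+ n′) :+ m :+ m′ :+ c :* (a :+ a :+ c)) :+ con 2 :* (c :* n′)) refl
    expandʳ : ∀ a c n n′ m m′ →
      ((a ⊕ c ⊕ n) ⊗ (a ⊕ c ⊕ n) ⊕ m′) ⊕ ((a ⊕ n′) ⊗ (a ⊕ n′) ⊕ m) ≡ common a c n n′ m m′ ⊕ (1# ⊕ 1#) ⊗ (c ⊗ n)
    expandʳ = solve 6 (λ a c n n′ m m′ →
      ((a :+ c :+ n) :* (a :+ c :+ n) :+ m′) :+ ((a :+ n′) :* (a :+ n′) :+ m) :=
      ((a :+ n) :* (a :+ n) :+ (a :+ n′) :* (a :+ n′) :+ m :+ m′ :+ c :* (a :+ a :+ c)) :+ con 2 :* (c :* n)) refl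

  -- The pin is the second argument, so `distVec F (y ∷ ys) x` unfolds to
  -- `dist x y ∷ distVec F ys x`: a further pin refines the partition by one coordinate.
  dist : ∀ {d} → Vec Carrier d → Vec Carrier d → Carrier
  dist x y = ‖_‖ F (_−_ F x y)

  -- Induction up to the first coordinate where x and x′ differ. An equal coordinate cancels and
  -- leaves q free choices of z; at a differing one, each choice of the remaining coordinates admits
  -- at most one z. The factor q on the left avoids the exponent d - 1.
  bisector-size : 1# ⊕ 1# ≢ 0# → ∀ {d} (x x′ : Vec Carrier d) → x ≢ x′ →
    q * (∑[ y ← points F d ] 𝟙 (dist x y ≟ dist x′ y)) ≤ q ^ d
  bisector-size 2≢0 [] [] x≢x′ = ⊥-elim (x≢x′ refl)
  bisector-size 2≢0 {suc d} (a ∷ x) (b ∷ x′) x≢x′ with a ≟ b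
  ... | yes refl = *-monoʳ-≤ q (begin
    ∑[ y ← points F (suc d) ] 𝟙 (dist (a ∷ x) y ≟ dist (a ∷ x′) y)
      ≡⟨ ∑-allVecs elements d _ ⟩
    ∑[ z ← elements ] ∑[ y ← points F d ] 𝟙 (dist (a ∷ x) (z ∷ y) ≟ dist (a ∷ x′) (z ∷ y))
      ≤⟨ ∑-mono elements (λ z → ∑-mono (points F d) (λ y → 𝟙-mono (_ ≟ _) (_ ≟ _) (𝔽ₚ.+-cancelˡ _ _ _))) ⟩
    ∑[ z ← elements ] ∑[ y ← points F d ] 𝟙 (dist x y ≟ dist x′ y)
      ≡⟨ ∑-const elements _ ⟩
    length elements * (∑[ y ← points F d ] 𝟙 (dist x y ≟ dist x′ y))
      ≡⟨ cong (_* (∑[ y ← points F d ] 𝟙 (dist x y ≟ dist x′ y))) length-elements ⟩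
    q * (∑[ y ← points F d ] 𝟙 (dist x y ≟ dist x′ y))
      ≤⟨ bisector-size 2≢0 x x′ (x≢x′ ∘ cong (a ∷_)) ⟩
    q ^ d ∎)
    where open ≤-Reasoning
  ... | no a≢b = *-monoʳ-≤ q (begin
    ∑[ y ← points F (suc d) ] 𝟙 (dist (a ∷ x) y ≟ dist (b ∷ x′) y)
      ≡⟨ ∑-allVecs elements d _ ⟩
    ∑[ z ← elements ] ∑[ y ← points F d ] 𝟙 (dist (a ∷ x) (z ∷ y) ≟ dist (b ∷ x′) (z ∷ y))
      ≡⟨ ∑-swap elements (points F d) _ ⟩
    ∑[ y ← points F d ] ∑[ z ← elements ] 𝟙 (dist (a ∷ x) (z ∷ y) ≟ dist (b ∷ x′) (z ∷ y))
      ≤⟨ ∑-mono (points F d) (λ y → ∑-𝟙-unique≤1 elements elements-enumerate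
           (λ z → dist (a ∷ x) (z ∷ y) ≟ dist (b ∷ x′) (z ∷ y)) (bisector-unique 2≢0 a≢b)) ⟩
    ∑[ y ← points F d ] 1
      ≡⟨ ∑-const (points F d) 1 ⟩
    length (points F d) * 1
      ≡⟨ trans (*-identityʳ _) (length-points d) ⟩
    q ^ d ∎)
    where open ≤-Reasoning

  -- Collision numbers and their refinement

  hits : ∀ {n} → List A → (A → Vec Carrier n) → Vec Carrier n → ℕ
  hits L f v = ∑[ x ← L ] 𝟙 (f x ≟ᵥ v)

  -- For L listing E and f = `distVec F ys` this is the number N(ys).
  collisions : ∀ {n} → List A → (A → Vec Carrier n) → ℕ
  collisions L f = ∑[ x ← L ] ∑[ x′ ← L ] 𝟙 (f x ≟ᵥ f x′)

  ∑-hits : ∀ {n} (L : List A) (f : A → Vec Carrier n) → ∑ (points F n) (hits L f) ≡ length L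
  ∑-hits {n = n} L f = trans (∑-swap (points F n) L _)
    (trans (∑-cong L (λ x → points-enumerate n (f x))) (trans (∑-const L 1) (*-identityʳ _)))

  -- A colliding pair is a pair inside one fibre of f. The square of a fibre size counts such pairs,
  -- and summing over v sifts out v = f x.
  collisions-hits : ∀ {n} (L : List A) (f : A → Vec Carrier n) →
    collisions L f ≡ ∑[ v ← points F n ] (hits L f v * hits L f v)
  collisions-hits {n = n} L f = sym (begin
    ∑[ v ← V ] (hits L f v * hits L f v)
      ≡⟨ ∑-cong V (λ v → ∑-* L L _ _) ⟩
    ∑[ v ← V ] ∑[ x ← L ] ∑[ x′ ← L ] (𝟙 (f x ≟ᵥ v) * 𝟙 (f x′ ≟ᵥ v))
      ≡⟨ ∑-swap V L _ ⟩
    ∑[ x ← L ] ∑[ v ← V ] ∑[ x′ ← L ] (𝟙 (f x ≟ᵥ v) * 𝟙 (f x′ ≟ᵥ v))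
      ≡⟨ ∑-cong L (λ x → ∑-swap V L _) ⟩
    ∑[ x ← L ] ∑[ x′ ← L ] ∑[ v ← V ] (𝟙 (f x ≟ᵥ v) * 𝟙 (f x′ ≟ᵥ v))
      ≡⟨ ∑-cong L (λ x → ∑-cong L (λ x′ → ∑-sift V (points-enumerate n) (f x) (λ v → 𝟙 (f x′ ≟ᵥ v)))) ⟩
    ∑[ x ← L ] ∑[ x′ ← L ] 𝟙 (f x′ ≟ᵥ f x)
      ≡⟨ ∑-cong L (λ x → ∑-cong L (λ x′ → 𝟙-cong (f x′ ≟ᵥ f x) (f x ≟ᵥ f x′) sym sym)) ⟩
    collisions L f ∎)
    where
    open ≡-Reasoning
    V = points F n

  hits-∷ : ∀ {n} (L : List A) (h : A → Carrier) (g : A → Vec Carrier n) s →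
    hits L g s ≡ ∑[ t ← elements ] hits L (λ x → h x ∷ g x) (t ∷ s)
  hits-∷ L h g s = begin
    ∑[ x ← L ] 𝟙 (g x ≟ᵥ s)
      ≡⟨ ∑-cong L (λ x → ∑-sift elements elements-enumerate (h x) (λ _ → 𝟙 (g x ≟ᵥ s))) ⟨
    ∑[ x ← L ] ∑[ t ← elements ] (𝟙 (h x ≟ t) * 𝟙 (g x ≟ᵥ s))
      ≡⟨ ∑-cong L (λ x → ∑-cong elements (λ t → 𝟙-∷ (h x) t (g x) s)) ⟨
    ∑[ x ← L ] ∑[ t ← elements ] 𝟙 ((h x ∷ g x) ≟ᵥ (t ∷ s))
      ≡⟨ ∑-swap L elements _ ⟩
    ∑[ t ← elements ] hits L (λ x → h x ∷ g x) (t ∷ s) ∎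
    where open ≡-Reasoning

  -- Each fibre of g splits into at most q fibres of (h, g), by the value of h; Cauchy-Schwarz
  -- against the constant 1 on each fibre gives the factor q. This makes the deviations in
  -- `collisions-extend` nonnegative.
  collisions-refine : ∀ {n} (L : List A) (h : A → Carrier) (g : A → Vec Carrier n) →
    collisions L g ≤ q * collisions L (λ x → h x ∷ g x)
  collisions-refine {n = n} L h g = begin
    collisions L g
      ≡⟨ collisions-hits L g ⟩
    ∑[ s ← V ] (hits L g s * hits L g s)
      ≡⟨ ∑-cong V (λ s → cong₂ _*_ (hits-∷ L h g s) (hits-∷ L h g s)) ⟩
    ∑[ s ← V ] (∑ elements (ν s) * ∑ elements (ν s))
      ≤⟨ ∑-mono V (λ s → cauchy-schwarz elements {p = λ _ → 1} (λ t → ≤-reflexive (sym (*-identityˡ _)))) ⟩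
    ∑[ s ← V ] ((∑[ _ ← elements ] 1) * (∑[ t ← elements ] (ν s t * ν s t)))
      ≡⟨ ∑-*ˡ V (∑[ _ ← elements ] 1) _ ⟩
    (∑[ _ ← elements ] 1) * (∑[ s ← V ] ∑[ t ← elements ] (ν s t * ν s t))
      ≡⟨ cong₂ _*_ (trans (∑-const elements 1) (trans (*-identityʳ _) length-elements)) (∑-swap V elements _) ⟩
    q * (∑[ t ← elements ] ∑[ s ← V ] (ν s t * ν s t))
      ≡⟨ cong (q *_) (∑-allVecs elements n _) ⟨
    q * (∑[ v ← points F (suc n) ] (hits L hg v * hits L hg v))
      ≡⟨ cong (q *_) (collisions-hits L hg) ⟨
    q * collisions L hg ∎
    where
    open ≤-Reasoning
    V = points F n
    hg = λ x → h x ∷ g x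
    ν = λ s t → hits L hg (t ∷ s)

  -- Adding one pin

  module _ (2≢0 : 1# ⊕ 1# ≢ 0#) {d : ℕ} (E : Subset F d) where
    private
      L = elemsOf F E
      n = card F E

    -- Off the diagonal this is the bisector bound; on it every one of the q^d points counts. The
    -- indicator merges both cases into a formula that can be summed over pairs.
    pair-count : (x x′ : Vec Carrier d) →
      q * (∑[ y ← points F d ] 𝟙 (dist x y ≟ dist x′ y)) ≤ q ^ d + 𝟙 (x ≟ᵥ x′) * q ^ suc d
    pair-count x x′ with x ≟ᵥ x′
    ... | no x≢x′ = ≤-trans (bisector-size 2≢0 x x′ x≢x′) (m≤m+n _ _)
    ... | yes refl = ≤-trans (*-monoʳ-≤ q (begin
      ∑[ y ← points F d ] 𝟙 (dist x y ≟ dist x y)   ≤⟨ ∑-mono (points F d) (λ y → 𝟙-mono (dist x y ≟ dist x y) (yes refl) (λ e → e)) ⟩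
      ∑[ _ ← points F d ] 1                         ≡⟨ ∑-const (points F d) 1 ⟩
      length (points F d) * 1                       ≡⟨ trans (*-identityʳ _) (length-points d) ⟩
      q ^ d                                         ∎)) (≤-trans (≤-reflexive (sym (*-identityˡ _))) (m≤n+m _ (q ^ d)))
      where open ≤-Reasoning

    -- Enlarging the inner sum to all points makes it exactly 1 for each x.
    diagonal-count : ∑[ x ← L ] ∑[ x′ ← L ] 𝟙 (x ≟ᵥ x′) ≤ n
    diagonal-count = begin
      ∑[ x ← L ] ∑[ x′ ← L ] 𝟙 (x ≟ᵥ x′)              ≤⟨ ∑-mono L (λ x → ∑-filter-≤ _ (points F d) _) ⟩
      ∑[ x ← L ] ∑[ x′ ← points F d ] 𝟙 (x ≟ᵥ x′)     ≡⟨ ∑-cong L (points-enumerate d) ⟩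
      ∑[ x ← L ] 1                                    ≡⟨ ∑-const L 1 ⟩
      n * 1                                           ≡⟨ *-identityʳ n ⟩
      n                                               ∎
      where open ≤-Reasoning

    -- A pair collides under y ∷ ys when it collides under ys and y is equidistant from both points.
    -- The q^d of `pair-count` gives the main term, the diagonal gives the error.
    collisions-all-pins : ∀ {k} (ys : Vec (Vec Carrier d) k) →
      ∑[ y ← points F d ] (q * collisions L (distVec F (y ∷ ys))) ≤
      q ^ d * collisions L (distVec F ys) + q ^ suc d * n
    collisions-all-pins ys = begin
      ∑[ y ← V ] (q * collisions L (distVec F (y ∷ ys)))
        ≡⟨ ∑-*ˡ V q _ ⟩
      q * (∑[ y ← V ] ∑[ x ← L ] ∑[ x′ ← L ] 𝟙 (distVec F (y ∷ ys) x ≟ᵥ distVec F (y ∷ ys) x′))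
        ≡⟨ cong (q *_) (trans (∑-swap V L _) (∑-cong L (λ x → ∑-swap V L _))) ⟩
      q * (∑[ x ← L ] ∑[ x′ ← L ] ∑[ y ← V ] 𝟙 (distVec F (y ∷ ys) x ≟ᵥ distVec F (y ∷ ys) x′))
        -- The indicator splits into a factor depending on y and the factor `same`, which leaves the
        -- sum over y.
        ≡⟨ cong (q *_) (∑-cong L (λ x → ∑-cong L (λ x′ → trans
             (∑-cong V (λ y → 𝟙-∷ (dist x y) (dist x′ y) (g x) (g x′))) (∑-*ʳ V _ (same x x′))))) ⟩
      q * (∑[ x ← L ] ∑[ x′ ← L ] (equidistant x x′ * same x x′))
        ≡⟨ trans (sym (∑-*ˡ L q _)) (∑-cong L (λ x → trans (sym (∑-*ˡ L q _))
             (∑-cong L (λ x′ → sym (*-assoc q (equidistant x x′) (same x x′)))))) ⟩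
      ∑[ x ← L ] ∑[ x′ ← L ] (q * equidistant x x′ * same x x′)
        ≤⟨ ∑-mono L (λ x → ∑-mono L (λ x′ → bound x x′)) ⟩
      ∑[ x ← L ] ∑[ x′ ← L ] (q ^ d * same x x′ + q ^ suc d * 𝟙 (x ≟ᵥ x′))
        ≡⟨ trans (∑-cong L (λ x → ∑-+ L _ _)) (∑-+ L _ _) ⟩
      (∑[ x ← L ] ∑[ x′ ← L ] (q ^ d * same x x′)) + (∑[ x ← L ] ∑[ x′ ← L ] (q ^ suc d * 𝟙 (x ≟ᵥ x′)))
        ≡⟨ cong₂ _+_ (trans (∑-cong L (λ x → ∑-*ˡ L (q ^ d) _)) (∑-*ˡ L (q ^ d) _))
                     (trans (∑-cong L (λ x → ∑-*ˡ L (q ^ suc d) _)) (∑-*ˡ L (q ^ suc d) _)) ⟩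
      q ^ d * collisions L g + q ^ suc d * (∑[ x ← L ] ∑[ x′ ← L ] 𝟙 (x ≟ᵥ x′))
        ≤⟨ +-monoʳ-≤ (q ^ d * collisions L g) (*-monoʳ-≤ (q ^ suc d) diagonal-count) ⟩
      q ^ d * collisions L g + q ^ suc d * n ∎
      where
      open ≤-Reasoning
      V = points F d
      g = distVec F ys
      same equidistant : Vec Carrier d → Vec Carrier d → ℕ
      same x x′ = 𝟙 (g x ≟ᵥ g x′)
      equidistant x x′ = ∑[ y ← V ] 𝟙 (dist x y ≟ dist x′ y)
      𝟙≤1 : (P? : Dec P) → 𝟙 P? ≤ 1
      𝟙≤1 (yes _) = ≤-refl
      𝟙≤1 (no _)  = z≤n
      distribute : ∀ a b c s → (a + b * c) * s ≡ a * s + c * b * s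
      distribute = solve-∀
      bound : ∀ x x′ → q * equidistant x x′ * same x x′ ≤ q ^ d * same x x′ + q ^ suc d * 𝟙 (x ≟ᵥ x′)
      bound x x′ = begin
        q * equidistant x x′ * same x x′                           ≤⟨ *-monoˡ-≤ (same x x′) (pair-count x x′) ⟩
        (q ^ d + 𝟙 (x ≟ᵥ x′) * q ^ suc d) * same x x′               ≡⟨ distribute (q ^ d) (𝟙 (x ≟ᵥ x′)) (q ^ suc d) (same x x′) ⟩
        q ^ d * same x x′ + q ^ suc d * 𝟙 (x ≟ᵥ x′) * same x x′     ≤⟨ +-monoʳ-≤ (q ^ d * same x x′) (*-monoʳ-≤ (q ^ suc d * 𝟙 (x ≟ᵥ x′)) (𝟙≤1 (g x ≟ᵥ g x′))) ⟩
        q ^ d * same x x′ + q ^ suc d * 𝟙 (x ≟ᵥ x′) * 1             ≡⟨ cong (q ^ d * same x x′ +_) (*-identityʳ _) ⟩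
        q ^ d * same x x′ + q ^ suc d * 𝟙 (x ≟ᵥ x′)                 ∎

    -- Over all points the total deviation of f from C is at most q^{d+1} n. As f ≥ C pointwise,
    -- `∑-deviation` passes this bound to the pins in E, whatever the structure of E. Adding q^d C
    -- to both sides replaces the subtraction.
    collisions-extend : ∀ {k} (ys : Vec (Vec Carrier d) k) →
      ∑[ y ← L ] (q * collisions L (distVec F (y ∷ ys))) ≤ n * collisions L (distVec F ys) + q ^ suc d * n
    collisions-extend ys = +-cancelʳ-≤ (q ^ d * C) _ _ (begin
      ∑ L f + q ^ d * C                       ≡⟨ cong (λ l → ∑ L f + l * C) (length-points d) ⟨
      ∑ L f + length (points F d) * C         ≤⟨ ∑-deviation _ (points F d) f C (λ y → collisions-refine L (λ x → dist x y) (distVec F ys)) ⟩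
      ∑ (points F d) f + n * C                ≤⟨ +-monoˡ-≤ (n * C) (collisions-all-pins ys) ⟩
      q ^ d * C + q ^ suc d * n + n * C       ≡⟨ rearrange (q ^ d * C) (q ^ suc d * n) (n * C) ⟩
      n * C + q ^ suc d * n + q ^ d * C       ∎)
      where
      open ≤-Reasoning
      C = collisions L (distVec F ys)
      f = λ y → q * collisions L (distVec F (y ∷ ys))
      rearrange : ∀ a b c → a + b + c ≡ c + b + a
      rearrange = solve-∀

    -- Recursion on the number of pins

    totalCollisions : ℕ → ℕ
    totalCollisions k = ∑[ ys ← allVecs L k ] collisions L (distVec F ys)

    totalCollisions-suc : ∀ k → q * totalCollisions (suc k) ≤ n * totalCollisions k + q ^ suc d * n * n ^ k
    totalCollisions-suc k = begin
      q * totalCollisions (suc k)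
        -- The new pin is the head of the vector; the swap fixes the old pins first, so that
        -- `collisions-extend` applies to each ys.
        ≡⟨ cong (q *_) (trans (∑-allVecs L k _) (∑-swap L Y _)) ⟩
      q * (∑[ ys ← Y ] ∑[ y ← L ] collisions L (distVec F (y ∷ ys)))
        ≡⟨ trans (sym (∑-*ˡ Y q _)) (∑-cong Y (λ ys → sym (∑-*ˡ L q _))) ⟩
      ∑[ ys ← Y ] ∑[ y ← L ] (q * collisions L (distVec F (y ∷ ys)))
        ≤⟨ ∑-mono Y collisions-extend ⟩
      ∑[ ys ← Y ] (n * collisions L (distVec F ys) + q ^ suc d * n)
        ≡⟨ ∑-+ Y _ _ ⟩
      (∑[ ys ← Y ] (n * collisions L (distVec F ys))) + (∑[ _ ← Y ] (q ^ suc d * n))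
        ≡⟨ cong₂ _+_ (∑-*ˡ Y n _) (∑-const Y _) ⟩
      n * totalCollisions k + length Y * (q ^ suc d * n)
        ≡⟨ cong (n * totalCollisions k +_) (trans (*-comm (length Y) _) (cong (q ^ suc d * n *_) (length-allVecs L k))) ⟩
      n * totalCollisions k + q ^ suc d * n * n ^ k ∎
      where
      open ≤-Reasoning
      Y = allVecs L k

    -- The main term n^{k+2} counts all triples (ys, x, x′). Each of the k recursion steps
    -- contributes one error term.
    totalCollisions-bound : ∀ k → q ^ k * totalCollisions k ≤ n ^ k * (n * n) + k * (q ^ (d + k) * n ^ k)
    totalCollisions-bound zero = begin
      1 * totalCollisions 0                     ≡⟨ trans (*-identityˡ _) (+-identityʳ _) ⟩
      ∑[ x ← L ] ∑[ x′ ← L ] 1                  ≡⟨ trans (∑-cong L (λ _ → trans (∑-const L 1) (*-identityʳ n))) (∑-const L n) ⟩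
      n * n                                     ≡⟨ trans (sym (*-identityˡ _)) (sym (+-identityʳ _)) ⟩
      1 * (n * n) + 0                           ∎
      where open ≤-Reasoning
    totalCollisions-bound (suc k) = begin
      q * q ^ k * N (suc k)
        ≡⟨ shuffle q (q ^ k) (N (suc k)) ⟩
      q ^ k * (q * N (suc k))
        ≤⟨ *-monoʳ-≤ (q ^ k) (totalCollisions-suc k) ⟩
      q ^ k * (n * N k + q ^ suc d * n * n ^ k)
        ≡⟨ expand (q ^ k) n (N k) q (q ^ d) (n ^ k) ⟩
      n * (q ^ k * N k) + q * (q ^ d * q ^ k) * (n * n ^ k)
        ≤⟨ +-monoˡ-≤ _ (*-monoʳ-≤ n (totalCollisions-bound k)) ⟩
      n * (n ^ k * (n * n) + k * (q ^ (d + k) * n ^ k)) + q * (q ^ d * q ^ k) * (n * n ^ k)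
        ≡⟨ cong (λ r → n * (n ^ k * (n * n) + k * (q ^ (d + k) * n ^ k)) + q * r * (n * n ^ k)) (^-distribˡ-+-* q d k) ⟨
      n * (n ^ k * (n * n) + k * (q ^ (d + k) * n ^ k)) + q * q ^ (d + k) * (n * n ^ k)
        ≡⟨ collect n (n ^ k) k (q ^ (d + k)) q ⟩
      n * n ^ k * (n * n) + (q * q ^ (d + k) * (n * n ^ k) + k * (q ^ (d + k) * (n * n ^ k)))
        -- The k older errors carry q^{d+k}; since q ≥ 1 they may be raised to q^{d+k+1}, the size
        -- of the new one.
        ≤⟨ +-monoʳ-≤ (n * n ^ k * (n * n)) (+-monoʳ-≤ (q * q ^ (d + k) * (n * n ^ k))
             (*-monoʳ-≤ k (*-monoˡ-≤ (n * n ^ k) (m≤n*m (q ^ (d + k)) q {{size≢0}})))) ⟩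
      n * n ^ k * (n * n) + (q * q ^ (d + k) * (n * n ^ k) + k * (q * q ^ (d + k) * (n * n ^ k)))
        ≡⟨ cong (λ e → n * n ^ k * (n * n) + suc k * (q ^ e * (n * n ^ k))) (+-suc d k) ⟨
      n * n ^ k * (n * n) + suc k * (q ^ (d + suc k) * (n * n ^ k)) ∎
      where
      open ≤-Reasoning
      N = totalCollisions
      shuffle : ∀ a b c → a * b * c ≡ b * (a * c)
      shuffle = solve-∀
      expand : ∀ r n N q p m → r * (n * N + q * p * n * m) ≡ n * (r * N) + q * (p * r) * (n * m)
      expand = solve-∀
      collect : ∀ n m k r q → n * (m * (n * n) + k * (r * m)) + q * r * (n * m) ≡
                              n * m * (n * n) + (q * r * (n * m) + k * (r * (n * m)))
      collect = solve-∀

    -- From collisions to distance sets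

    card²≤Δ*collisions : ∀ {k} (ys : Vec (Vec Carrier d) k) → n * n ≤ card F (Δ F E ys) * collisions L (distVec F ys)
    card²≤Δ*collisions {k} ys = begin
      n * n
        ≡⟨ cong₂ _*_ (∑-hits L f) (∑-hits L f) ⟨
      ∑ V (hits L f) * ∑ V (hits L f)
        -- The weight p is the indicator of Δ, with sum |Δ|. It is admissible because no point of E
        -- has its distance vector outside Δ.
        ≤⟨ cauchy-schwarz V {p = λ t → 𝟙 (Δ F E ys t Bool.≟ true)} supported ⟩
      (∑[ t ← V ] 𝟙 (Δ F E ys t Bool.≟ true)) * (∑[ t ← V ] (hits L f t * hits L f t))
        ≡⟨ cong₂ _*_ (𝟙-filter (λ t → Δ F E ys t Bool.≟ true) V) (collisions-hits L f) ⟨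
      card F (Δ F E ys) * collisions L f ∎
      where
      open ≤-Reasoning
      V = points F k
      f = distVec F ys
      supported : ∀ t → hits L f t * hits L f t ≤ 𝟙 (Δ F E ys t Bool.≟ true) * (hits L f t * hits L f t)
      supported t with Δ F E ys t in eq
      ... | true  = ≤-reflexive (sym (*-identityˡ _))
      ... | false = ≤-reflexive (cong (λ h → h * h) (any≡false⇒∑≡0 (λ x → f x ≟ᵥ t) L eq))

    -- Cauchy-Schwarz a second time, over ys ∈ E^k with constant u = n; the preceding pointwise
    -- bound is exactly its hypothesis.
    card^≤sumΔ*totalCollisions : ∀ k → n ^ k * n * (n ^ k * n) ≤ sumΔ F k E * totalCollisions k
    card^≤sumΔ*totalCollisions k = subst (λ s → s * s ≤ sumΔ F k E * totalCollisions k)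
      (trans (∑-const (allVecs L k) n) (cong (_* n) (length-allVecs L k)))
      (cauchy-schwarz (allVecs L k) card²≤Δ*collisions)

    -- α and β stand for a² and b².
    sumΔ-lower-bound : ∀ α β k → 1 ≤ k → α * q ^ (d + k) ≤ β * n ^ 2 →
      α * q ^ k * n ^ k ≤ (α + k * β) * sumΔ F k E
    sumΔ-lower-bound α β (suc j) 1≤k αq≤βn² with n in n≡
    -- For empty E the left side vanishes because k ≥ 1; the power 0^0 would be 1.
    ... | zero  = ≤-trans (≤-reflexive (*-zeroʳ (α * q ^ suc j))) z≤n
    ... | suc i = subst (λ n → α * q ^ k * n ^ k ≤ (α + k * β) * S) n≡
        -- Multiplying by n^{k+2} > 0 turns the left side into α q^k times the square in
        -- `card^≤sumΔ*totalCollisions`.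
        (*-cancelʳ-≤ _ _ (n ^ k * (n * n)) {{nonZero}} (begin
      α * q ^ k * n ^ k * (n ^ k * (n * n))
        ≡⟨ square α (q ^ k) (n ^ k) n ⟩
      α * q ^ k * (n ^ k * n * (n ^ k * n))
        ≤⟨ *-monoʳ-≤ (α * q ^ k) (card^≤sumΔ*totalCollisions k) ⟩
      α * q ^ k * (S * totalCollisions k)
        ≡⟨ group α (q ^ k) S (totalCollisions k) ⟩
      S * (α * (q ^ k * totalCollisions k))
        ≤⟨ *-monoʳ-≤ S (*-monoʳ-≤ α (totalCollisions-bound k)) ⟩
      S * (α * (n ^ k * (n * n) + k * (q ^ (d + k) * n ^ k)))
        ≡⟨ distribute S α (n ^ k) n k (q ^ (d + k)) ⟩
      S * (α * (n ^ k * (n * n)) + k * (α * q ^ (d + k) * n ^ k))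
        -- The size hypothesis bounds each of the k errors by β n^{k+2}, next to the main term α
        -- n^{k+2}; hence the constant α + kβ.
        ≤⟨ *-monoʳ-≤ S (+-monoʳ-≤ (α * (n ^ k * (n * n))) (*-monoʳ-≤ k (*-monoˡ-≤ (n ^ k)
             (subst (λ n → α * q ^ (d + k) ≤ β * n ^ 2) (sym n≡) αq≤βn²)))) ⟩
      S * (α * (n ^ k * (n * n)) + k * (β * (n * (n * 1)) * n ^ k))
        ≡⟨ collect S α (n ^ k) n k β ⟩
      (α + k * β) * S * (n ^ k * (n * n)) ∎))
      where
      open ≤-Reasoning
      k = suc j
      S = sumΔ F k E
      instance
        n≢0 : NonZero n
        n≢0 = subst NonZero (sym n≡) _
      nonZero : NonZero (n ^ k * (n * n))
      nonZero = m*n≢0 (n ^ k) (n * n) {{m^n≢0 n k}} {{m*n≢0 n n}}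
      square : ∀ α r m n → α * r * m * (m * (n * n)) ≡ α * r * (m * n * (m * n))
      square = solve-∀
      group : ∀ α r S N → α * r * (S * N) ≡ S * (α * (r * N))
      group = solve-∀
      distribute : ∀ S α m n k r → S * (α * (m * (n * n) + k * (r * m))) ≡ S * (α * (m * (n * n)) + k * (α * r * m))
      distribute = solve-∀
      collect : ∀ S α m n k β → S * (α * (m * (n * n)) + k * (β * (n * (n * 1)) * m)) ≡ (α + k * β) * S * (m * (n * n))
      collect = solve-∀

theorem2p12 : (d k : ℕ) → 1 ≤ k → (a b : ℕ) → 1 ≤ a → 1 ≤ b →
    Σ ℕ (λ m → Σ ℕ (λ n → 1 ≤ m × 1 ≤ n ×
    ((F : FiniteField) → IsOddPrimePower (FiniteField.size F) →
    (E : Subset F d) →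
    (a ^ 2) * (FiniteField.size F ^ (d + k)) ≤ (b ^ 2) * (card F E ^ 2) →
    m * (FiniteField.size F ^ k) * (card F E ^ k) ≤ n * sumΔ F k E)))
theorem2p12 d k 1≤k a b 1≤a 1≤b =
  -- With c₀ = a/b the constant in the conclusion is c₀²/(c₀² + k).
  a ^ 2 , a ^ 2 + k * b ^ 2 , 1≤a² , ≤-trans 1≤a² (m≤m+n _ _) ,
  λ F q-odd E large →
    sumΔ-lower-bound F (odd-size⇒1+1≢0 F (odd-prime-power⇒odd q-odd)) E (a ^ 2) (b ^ 2) k 1≤k large
  where
  1≤a² : 1 ≤ a ^ 2
  1≤a² = ^-monoˡ-≤ 2 1≤a
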